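{- Let $a,b,N,M\in\mathbb{N}$ with $b\mid a$ and $N\le M$. Then $$[q^n]\,g_{a,b,a+b}(N,M;q)\ge 0\qquad\text{for all integers }0\le n<a+2(a+b).$$ Equivalently, for all $k,N,M\in\mathbb{N}$ with $N\le M$, $$[x^r]\,G_{k,N,M}(x)\ge 0\qquad\text{for all integers }0\le r<3k+2.$$
   Context: $\mathbb{N}$ is the set of positive integers. Notation: $(z;q)_n=\prod_{i=0}^{n-1}(1-zq^i)$; $[q^n]f$ denotes the coefficient of $q^n$ in the formal power series $f$. For $a,b,m,N,M\in\mathbb{N}$, $$g_{a,b,m}(N,M;q):=\frac{(-q^m;q^m)_{N+M-1}}{(-q^a;q^m)_N\,(q^b;q^m)_M},$$ and for $k,N,M\in\mathbb{N}$, $$G_{k,N,M}(x):=\frac{(-x^{k+1};x^{k+1})_{N+M-1}}{(-x^{k};x^{k+1})_N\,(x;x^{k+1})_M},$$ both expanded as formal power series. When $a=kb$ one has $G_{k,N,M}(q^b)=g_{a,b,a+b}(N,M;q)$. -}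

module Defs where

open import Data.Fin.Base using (Fin; zero; suc; toℕ)
open import Data.Integer.Base as ℤ using (ℤ; 0ℤ; 1ℤ)
import Data.Integer.Properties as ℤ
open import Data.Nat.Base as ℕ using (ℕ; zero; suc; NonZero; _∸_)
open import Data.Vec.Functional using (Vector; _∷_)
open import Relation.Binary.PropositionalEquality
  using (_≡_; _≗_; refl; sym; trans; cong; cong₂)

open import Algebra.Properties.CommutativeMonoid.Sum ℤ.+-0-commutativeMonoid
  using (sum⁺-syntax; sum-cong-≗)

-- ℤ[[X]]: a formal power series is its sequence of coefficients, and
-- equality of series is pointwise equality _≗_.

Series : Set
Series = ℕ → ℤ

[X^_]_ : ℕ → Series → ℤ
[X^ n ] f = f n

infix  9 [X^_]_
infixl 6 _-_
infixl 7 _*_ _/_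
infixr 8 _^_
infix  8 -_
infix  9 _⁻¹

𝟙 : Series
𝟙 zero    = 1ℤ
𝟙 (suc _) = 0ℤ

X : Series
X zero          = 0ℤ
X (suc zero)    = 1ℤ
X (suc (suc _)) = 0ℤ

-_ : Series → Series
(- f) n = ℤ.- f n

_-_ : Series → Series → Series
(f - g) n = f n ℤ.- g n

_*_ : Series → Series → Series
(f * g) n = ∑[ i ≤ n ] (f (toℕ i) ℤ.* g (n ∸ toℕ i))

_^_ : Series → ℕ → Series
f ^ zero  = 𝟙
f ^ suc n = f * f ^ n

-- Coefficients n, n-1, …, 0 (in this order) of the inverse of a series with
-- constant term 1, from h₀ = 1 and hₙ₊₁ = - Σ_{i ≤ n} fᵢ₊₁ hₙ₋ᵢ.
inverseCoeffs : Series → (n : ℕ) → Vector ℤ (suc n)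
inverseCoeffs f zero    = λ _ → 1ℤ
inverseCoeffs f (suc n) =
  (ℤ.- (∑[ i ≤ n ] (f (suc (toℕ i)) ℤ.* inverseCoeffs f n i)))
  ∷ inverseCoeffs f n

-- Meaningful only for series with constant term 1; see *-inverseʳ.
_⁻¹ : Series → Series
(f ⁻¹) n = inverseCoeffs f n zero

_/_ : Series → Series → Series
f / g = f * g ⁻¹

-- (z;q)ₙ = ∏_{i<n} (1 - z qⁱ)
poch : (z q : Series) → ℕ → Series
poch z q zero    = 𝟙
poch z q (suc n) = poch z q n * (𝟙 - z * q ^ n)

gDenominator : (a b m N M : ℕ) → Series
gDenominator a b m N M =
  poch (- (X ^ a)) (X ^ m) N * poch (X ^ b) (X ^ m) M

g : (a b m N M : ℕ) → Series
g a b m N M =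
  poch (- (X ^ m)) (X ^ m) (N ℕ.+ M ∸ 1) / gDenominator a b m N M

GDenominator : (k N M : ℕ) → Series
GDenominator k N M =
  poch (- (X ^ k)) (X ^ (k ℕ.+ 1)) N * poch X (X ^ (k ℕ.+ 1)) M

G : (k N M : ℕ) → Series
G k N M =
  poch (- (X ^ (k ℕ.+ 1))) (X ^ (k ℕ.+ 1)) (N ℕ.+ M ∸ 1) / GDenominator k N M

-- The divisions in g and G are genuine: _⁻¹ inverts every series with constant
-- term 1, and both denominators have constant term 1.

inverseCoeffs-⁻¹ : ∀ f n (i : Fin (suc n)) →
                   inverseCoeffs f n i ≡ (f ⁻¹) (n ∸ toℕ i)
inverseCoeffs-⁻¹ f zero    zero    = refl
inverseCoeffs-⁻¹ f (suc n) zero    = refl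
inverseCoeffs-⁻¹ f (suc n) (suc i) = inverseCoeffs-⁻¹ f n i

*-inverseʳ : ∀ f → f 0 ≡ 1ℤ → f * f ⁻¹ ≗ 𝟙
*-inverseʳ f f₀≡1 zero    rewrite f₀≡1 = refl
*-inverseʳ f f₀≡1 (suc n) rewrite f₀≡1 =
  trans (cong₂ ℤ._+_ (ℤ.*-identityˡ ((f ⁻¹) (suc n)))
          (sum-cong-≗ {suc n} λ i →
            cong (f (suc (toℕ i)) ℤ.*_) (sym (inverseCoeffs-⁻¹ f n i))))
        (ℤ.+-inverseˡ (∑[ i ≤ n ] (f (suc (toℕ i)) ℤ.* inverseCoeffs f n i)))

*-constant : ∀ f h → (f * h) 0 ≡ f 0 ℤ.* h 0
*-constant f h = ℤ.+-identityʳ _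

X^-constant : ∀ n → .{{NonZero n}} → (X ^ n) 0 ≡ 0ℤ
X^-constant (suc n) = *-constant X (X ^ n)

poch-constant : ∀ z q n → z 0 ≡ 0ℤ → poch z q n 0 ≡ 1ℤ
poch-constant z q zero    z₀≡0 = refl
poch-constant z q (suc n) z₀≡0
  rewrite *-constant (poch z q n) (𝟙 - z * q ^ n)
        | poch-constant z q n z₀≡0
        | *-constant z (q ^ n)
        | z₀≡0 = refl

gDenominator-constant : ∀ a b m N M → .{{NonZero a}} → .{{NonZero b}} →
                        gDenominator a b m N M 0 ≡ 1ℤ
gDenominator-constant a b m N M =
  trans (*-constant (poch (- (X ^ a)) (X ^ m) N) (poch (X ^ b) (X ^ m) M))
        (cong₂ ℤ._*_
          (poch-constant (- (X ^ a)) (X ^ m) N (cong ℤ.-_ (X^-constant a)))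
          (poch-constant (X ^ b) (X ^ m) M (X^-constant b)))

GDenominator-constant : ∀ k N M → .{{NonZero k}} → GDenominator k N M 0 ≡ 1ℤ
GDenominator-constant k N M =
  trans (*-constant (poch (- (X ^ k)) (X ^ (k ℕ.+ 1)) N) (poch X (X ^ (k ℕ.+ 1)) M))
        (cong₂ ℤ._*_
          (poch-constant (- (X ^ k)) (X ^ (k ℕ.+ 1)) N (cong ℤ.-_ (X^-constant k)))
          (poch-constant X (X ^ (k ℕ.+ 1)) M refl))

{-# OPTIONS --safe #-}

-- Put y = X^b, u = y^k and q = y^(k+1). Modulo y^(3k+2) only the first two
-- factors 1 + u, 1 + uq of (-u;q)_N matter, numerator factors 1 + qⁱ⁺¹ and
-- denominator factors 1 - yqⁱ preserve nonnegativity, so it suffices to pair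
-- 1 + u and 1 + uq with finitely many factors of these two kinds:
--   (1 + q) / ((1 + u)(1 - y)) = (1 + q)(1 + y + ⋯ + yᵏ⁻¹) / (1 - u²)
-- settles N = 1; for N, M ≥ 2 and k ≥ 2 the quotient
--   (1 + q)(1 + q²) / ((1 + u)(1 + uq)(1 - y))
-- is an explicit polynomial with nonnegative coefficients modulo y^(3k+2), and
-- for k = 1 one uses (1 + y)(1 + y³)(1 - y)(1 - y³) = (1 - y²)(1 - y⁶).

module Submission where

open import Algebra.Bundles using (CommutativeRing)
open import Algebra.Solver.Ring.AlmostCommutativeRing using (_-Raw-AlmostCommutative⟶_; fromCommutativeRing)
open import Data.Integer.Base as ℤ using (ℤ; +_; -[1+_]; 0ℤ; 1ℤ)
import Data.Integer.Properties as ℤ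
open import Data.Maybe.Base using (Maybe; map)
open import Data.Nat.Base as ℕ using (ℕ; zero; suc; _∸_; _≤_; _<_; z≤n; s≤s; _≤′_; ≤′-refl; ≤′-step)
import Data.Nat.Properties as ℕ
open import Data.Fin.Base using (toℕ)
open import Data.Product.Base using (_,_)
open import Function.Base using (_∘_)
open import Level as Level using (0ℓ; _⊔_)
open import Relation.Binary.PropositionalEquality as ≡ using (_≡_; _≗_; module ≡-Reasoning)
open import Relation.Binary.Consequences using (dec⇒weaklyDec)

-- Ring solver with integer constants over an arbitrary commutative ring

module IntegerSolver {c ℓ} (R : CommutativeRing c ℓ) where

  open CommutativeRing R
  open import Algebra.Properties.Ring ring using (-0#≈0#; -‿involutive; -‿distribˡ-*; -‿distribʳ-*; -‿+-comm)
  open import Algebra.Properties.Semiring.Mult.TCOptimised semiring using (_×_; ×-homo-+; ×1-homo-*; 1+×)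
  open import Relation.Binary.Reasoning.Setoid setoid

  -- With the type-checking-optimised _×_, constant 0ℤ and constant 1ℤ reduce to
  -- 0# and 1#, so that con 0ℤ and con 1ℤ match these in goals.
  constant : ℤ → Carrier
  constant (+ n)    = n × 1#
  constant -[1+ n ] = - (suc n × 1#)

  constant-neg : ∀ i → constant (ℤ.- i) ≈ - constant i
  constant-neg (+ zero)  = sym -0#≈0#
  constant-neg (+ suc n) = refl
  constant-neg -[1+ n ]  = sym (-‿involutive (suc n × 1#))

  constant-⊖ : ∀ m n → constant (m ℤ.⊖ n) ≈ m × 1# - n × 1#
  constant-⊖ m       zero    = sym (trans (+-congˡ -0#≈0#) (+-identityʳ (m × 1#)))
  constant-⊖ zero    (suc n) = sym (+-identityˡ (- (suc n × 1#)))
  constant-⊖ (suc m) (suc n) = begin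
    constant (suc m ℤ.⊖ suc n)                 ≡⟨ ≡.cong constant (ℤ.[1+m]⊖[1+n]≡m⊖n m n) ⟩
    constant (m ℤ.⊖ n)                         ≈⟨ constant-⊖ m n ⟩
    m × 1# - n × 1#                            ≈⟨ +-congʳ (+-identityʳ (m × 1#)) ⟨
    m × 1# + 0# - n × 1#                       ≈⟨ +-congʳ (+-congˡ (-‿inverseʳ 1#)) ⟨
    m × 1# + (1# - 1#) - n × 1#                ≈⟨ +-congʳ (+-assoc (m × 1#) 1# (- 1#)) ⟨
    m × 1# + 1# - 1# - n × 1#                  ≈⟨ +-congʳ (+-congʳ (+-comm (m × 1#) 1#)) ⟩
    1# + m × 1# - 1# - n × 1#                  ≈⟨ +-assoc (1# + m × 1#) (- 1#) (- (n × 1#)) ⟩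
    1# + m × 1# + (- 1# - n × 1#)              ≈⟨ +-congˡ (-‿+-comm 1# (n × 1#)) ⟩
    1# + m × 1# - (1# + n × 1#)                ≈⟨ +-cong (1+× m 1#) (-‿cong (1+× n 1#)) ⟨
    suc m × 1# - suc n × 1#                    ∎

  constant-+ : ∀ i j → constant (i ℤ.+ j) ≈ constant i + constant j
  constant-+ (+ m)    (+ n)    = ×-homo-+ 1# m n
  constant-+ (+ m)    -[1+ n ] = constant-⊖ m (suc n)
  constant-+ -[1+ m ] (+ n)    = trans (constant-⊖ n (suc m)) (+-comm (n × 1#) _)
  constant-+ -[1+ m ] -[1+ n ] = begin
    - (suc (suc (m ℕ.+ n)) × 1#)          ≡⟨ ≡.cong (λ l → - (l × 1#)) (ℕ.+-suc (suc m) n) ⟨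
    - ((suc m ℕ.+ suc n) × 1#)            ≈⟨ -‿cong (×-homo-+ 1# (suc m) (suc n)) ⟩
    - (suc m × 1# + suc n × 1#)           ≈⟨ -‿+-comm (suc m × 1#) (suc n × 1#) ⟨
    - (suc m × 1#) - suc n × 1#           ∎

  -- A nonnegative first factor is treated separately, because a negative one reduces to it by
  -- pulling out the sign.
  constant-*⁺ : ∀ m j → constant (+ m ℤ.* j) ≈ constant (+ m) * constant j
  constant-*⁺ m (+ n)    = trans (reflexive (≡.cong constant (≡.sym (ℤ.pos-* m n)))) (×1-homo-* m n)
  constant-*⁺ m -[1+ n ] = begin
    constant (+ m ℤ.* -[1+ n ])           ≡⟨ ≡.cong constant (ℤ.neg-distribʳ-* (+ m) (+ suc n)) ⟨
    constant (ℤ.- (+ m ℤ.* + suc n))      ≈⟨ constant-neg (+ m ℤ.* + suc n) ⟩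
    - constant (+ m ℤ.* + suc n)          ≈⟨ -‿cong (constant-*⁺ m (+ suc n)) ⟩
    - (m × 1# * (suc n × 1#))             ≈⟨ -‿distribʳ-* (m × 1#) (suc n × 1#) ⟩
    m × 1# * - (suc n × 1#)               ∎

  constant-* : ∀ i j → constant (i ℤ.* j) ≈ constant i * constant j
  constant-* (+ m)    j = constant-*⁺ m j
  constant-* -[1+ m ] j = begin
    constant (-[1+ m ] ℤ.* j)             ≡⟨ ≡.cong constant (ℤ.neg-distribˡ-* (+ suc m) j) ⟨
    constant (ℤ.- (+ suc m ℤ.* j))        ≈⟨ constant-neg (+ suc m ℤ.* j) ⟩
    - constant (+ suc m ℤ.* j)            ≈⟨ -‿cong (constant-*⁺ (suc m) j) ⟩
    - (suc m × 1# * constant j)           ≈⟨ -‿distribˡ-* (suc m × 1#) (constant j) ⟩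
    - (suc m × 1#) * constant j           ∎

  constant-homo : ℤ.+-*-rawRing -Raw-AlmostCommutative⟶ fromCommutativeRing R
  constant-homo = record
    { ⟦_⟧    = constant
    ; +-homo = constant-+
    ; *-homo = constant-*
    ; -‿homo = constant-neg
    ; 0-homo = refl
    ; 1-homo = refl
    }

  constant-≟ : ∀ i j → Maybe (constant i ≈ constant j)
  constant-≟ i j = map (λ i≡j → reflexive (≡.cong constant i≡j)) (dec⇒weaklyDec ℤ._≟_ i j)

  open import Algebra.Solver.Ring ℤ.+-*-rawRing (fromCommutativeRing R) constant-homo constant-≟ public
    using (solve; _:=_; _:+_; _:*_; _:-_; :-_; con)

-- Nonnegative quotients in an abstract commutative ring

≤-induction : ∀ {p} (P : ℕ → Set p) → (∀ n → P n → P (suc n)) → ∀ {m n} → m ≤ n → P m → P n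
≤-induction P step m≤n Pm = go (ℕ.≤⇒≤′ m≤n)
  where
  go : ∀ {n} → _ ≤′ n → P n
  go ≤′-refl       = Pm
  go (≤′-step m≤n) = step _ (go m≤n)

-- These closure properties are all that the argument asks of coefficientwise nonnegativity, so it
-- can run over an abstract ring and is applied to power series only at the end.
record Cone {c ℓ} (R : CommutativeRing c ℓ) p : Set (c ⊔ Level.suc p) where
  open CommutativeRing R
  field
    Nonneg   : Carrier → Set p
    0-nonneg : Nonneg 0#
    1-nonneg : Nonneg 1#
    +-nonneg : ∀ {x y} → Nonneg x → Nonneg y → Nonneg (x + y)
    *-nonneg : ∀ {x y} → Nonneg x → Nonneg y → Nonneg (x * y)

module NonnegativeQuotients {c ℓ p} (R : CommutativeRing c ℓ) (C : Cone R p) where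

  open CommutativeRing R
  open Cone C
  open IntegerSolver R
  open import Algebra.Properties.CommutativeSemiring.Exp commutativeSemiring
    using (_^_; ^-homo-*; ^-distrib-*)
  open import Relation.Binary.Reasoning.Setoid setoid

  pochhammer : Carrier → Carrier → ℕ → Carrier
  pochhammer z q zero    = 1#
  pochhammer z q (suc n) = pochhammer z q n * (1# - z * q ^ n)

  -- Horner form of 1 + x + ⋯ + xⁿ⁻¹, suited to induction on `n`.
  geometric : Carrier → ℕ → Carrier
  geometric x zero    = 0#
  geometric x (suc n) = 1# + x * geometric x n

  geometric-sum : ∀ x n → geometric x n * (1# - x) ≈ 1# - x ^ n
  geometric-sum x zero    = solve 1 (λ x → con 0ℤ :* (con 1ℤ :- x) := con 1ℤ :- con 1ℤ) refl x
  geometric-sum x (suc n) = begin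
    (1# + x * geometric x n) * (1# - x)
      ≈⟨ solve 2 (λ x s → (con 1ℤ :+ x :* s) :* (con 1ℤ :- x) := con 1ℤ :- x :+ x :* (s :* (con 1ℤ :- x)))
           refl x (geometric x n) ⟩
    1# - x + x * (geometric x n * (1# - x))
      ≈⟨ +-congˡ (*-congˡ (geometric-sum x n)) ⟩
    1# - x + x * (1# - x ^ n)
      ≈⟨ solve 2 (λ x v → con 1ℤ :- x :+ x :* (con 1ℤ :- v) := con 1ℤ :- x :* v) refl x (x ^ n) ⟩
    1# - x * x ^ n ∎

  ^-nonneg : ∀ {x} n → Nonneg x → Nonneg (x ^ n)
  ^-nonneg zero    x≥0 = 1-nonneg
  ^-nonneg (suc n) x≥0 = *-nonneg x≥0 (^-nonneg n x≥0)

  geometric-nonneg : ∀ {x} n → Nonneg x → Nonneg (geometric x n)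
  geometric-nonneg zero    x≥0 = 0-nonneg
  geometric-nonneg (suc n) x≥0 = +-nonneg 1-nonneg (*-nonneg x≥0 (geometric-nonneg n x≥0))

  -- n / d agrees modulo t with a nonnegative element.
  record NonnegQuotient (t n d : Carrier) : Set (c ⊔ ℓ ⊔ p) where
    constructor mkQuotient
    field
      {quotient}      : Carrier
      {remainder}     : Carrier
      quotient-nonneg : Nonneg quotient
      division        : quotient * d ≈ n + t * remainder

  quotient-cong : ∀ {t t′ n n′ d d′} → t ≈ t′ → n ≈ n′ → d ≈ d′ → NonnegQuotient t n d → NonnegQuotient t′ n′ d′
  quotient-cong t≈t′ n≈n′ d≈d′ (mkQuotient h≥0 eq) =
    mkQuotient h≥0 (trans (*-congˡ (sym d≈d′)) (trans eq (+-cong n≈n′ (*-congʳ t≈t′))))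

  -- Every cross term in the product of the two divisions contains `t`, so a quotient can be
  -- assembled factor by factor.
  quotient-* : ∀ {t n d n′ d′} → NonnegQuotient t n d → NonnegQuotient t n′ d′ → NonnegQuotient t (n * n′) (d * d′)
  quotient-* {t} {n} {d} {n′} {d′} (mkQuotient {h} {r} h≥0 eq) (mkQuotient {h′} {r′} h′≥0 eq′) =
    mkQuotient (*-nonneg h≥0 h′≥0) (begin
      (h * h′) * (d * d′)
        ≈⟨ solve 4 (λ h h′ d d′ → (h :* h′) :* (d :* d′) := (h :* d) :* (h′ :* d′)) refl h h′ d d′ ⟩
      (h * d) * (h′ * d′)
        ≈⟨ *-cong eq eq′ ⟩
      (n + t * r) * (n′ + t * r′)
        ≈⟨ solve 5 (λ n n′ t r r′ → (n :+ t :* r) :* (n′ :+ t :* r′)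
             := n :* n′ :+ t :* (r :* n′ :+ n :* r′ :+ t :* (r :* r′))) refl n n′ t r r′ ⟩
      n * n′ + t * (r * n′ + n * r′ + t * (r * r′)) ∎)

  quotient-x/1 : ∀ {t x} → Nonneg x → NonnegQuotient t x 1#
  quotient-x/1 {t} {x} x≥0 =
    mkQuotient x≥0 (solve 2 (λ t x → x :* con 1ℤ := x :+ t :* con 0ℤ) refl t x)

  -- The geometric series of yw cut after `m` terms has error (yw)ᵐ, a multiple of yᵐ. Taking w = qⁱ
  -- covers each factor 1 - yqⁱ of the denominator.
  quotient-1/[1-yw] : ∀ {y w} m → Nonneg y → Nonneg w → NonnegQuotient (y ^ m) 1# (1# - y * w)
  quotient-1/[1-yw] {y} {w} m y≥0 w≥0 =
    mkQuotient (geometric-nonneg m (*-nonneg y≥0 w≥0)) (begin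
      geometric (y * w) m * (1# - y * w)
        ≈⟨ geometric-sum (y * w) m ⟩
      1# - (y * w) ^ m
        ≈⟨ +-congˡ (-‿cong (^-distrib-* y w m)) ⟩
      1# - y ^ m * w ^ m
        ≈⟨ solve 2 (λ a b → con 1ℤ :- a :* b := con 1ℤ :+ a :* (:- b)) refl (y ^ m) (w ^ m) ⟩
      1# + y ^ m * - (w ^ m) ∎)

  -- Working modulo y³ᵏ⁺²: induction steps and the case N = 1

  module Truncation {y} (y≥0 : Nonneg y) (k-1 : ℕ) where

    -- The parameter is k - 1, so that `u` unfolds to `y * y ^ k-1`. The sum defining `order` is 3k
    -- + 2 split as the exponents of u, q and q.
    k order : ℕ
    k = suc k-1
    order = k ℕ.+ (suc k ℕ.+ suc k)

    u q : Carrier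
    u = y ^ k
    q = y ^ suc k

    u≥0 : Nonneg u
    u≥0 = ^-nonneg k y≥0

    q≥0 : Nonneg q
    q≥0 = ^-nonneg (suc k) y≥0

    uq²≈y^order : u * (q * q) ≈ y ^ order
    uq²≈y^order = sym (trans (^-homo-* y k (suc k ℕ.+ suc k)) (*-congˡ (^-homo-* y (suc k) (suc k))))

    numerator : ℕ → Carrier
    numerator l = pochhammer (- q) q l

    denominator : ℕ → ℕ → Carrier
    denominator N M = pochhammer (- u) q N * pochhammer y q M

    -- Positive (N + M ∸ 1) N M says that G_{k,N,M}(y) is nonnegative modulo
    -- y^(3k+2); the number l of numerator factors is varied independently.
    Positive : ℕ → ℕ → ℕ → Set (c ⊔ ℓ ⊔ p)
    Positive l N M = NonnegQuotient (y ^ order) (numerator l) (denominator N M)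

    positive-sucˡ : ∀ N M l → Positive l N M → Positive (suc l) N M
    positive-sucˡ N M l pos =
      quotient-cong refl
        (*-congˡ (solve 2 (λ q v → con 1ℤ :+ q :* v := con 1ℤ :- (:- q) :* v) refl q (q ^ l)))
        (*-identityʳ _)
        (quotient-* pos (quotient-x/1 (+-nonneg 1-nonneg (*-nonneg q≥0 (^-nonneg l q≥0)))))

    positive-sucᴹ : ∀ l N M → Positive l N M → Positive l N (suc M)
    positive-sucᴹ l N M pos =
      quotient-cong refl (*-identityʳ _) (*-assoc _ _ _)
        (quotient-* pos (quotient-1/[1-yw] order y≥0 (^-nonneg M q≥0)))

    -- The new denominator factor 1 + u qᴺ⁺² is 1 modulo y ^ order.
    positive-sucᴺ : ∀ l M N → Positive l (2 ℕ.+ N) M → Positive l (3 ℕ.+ N) M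
    positive-sucᴺ l M N pos =
      quotient-cong refl (*-identityʳ _)
        (solve 3 (λ a b c → a :* b :* c := a :* c :* b) refl
          (pochhammer (- u) q (2 ℕ.+ N)) (pochhammer y q M) (1# - (- u) * q ^ (2 ℕ.+ N)))
        (quotient-* pos (quotient-cong uq²≈y^order refl refl
          (mkQuotient 1-nonneg
            (solve 3 (λ u q v → con 1ℤ :* (con 1ℤ :- (:- u) :* (q :* (q :* v))) := con 1ℤ :+ u :* (q :* q) :* v)
              refl u q (q ^ N)))))

    positive-1-1-1 : Positive 1 1 1
    positive-1-1-1 =
      mkQuotient
        (*-nonneg (+-nonneg 1-nonneg q≥0) (*-nonneg (geometric-nonneg k y≥0) f≥0))
        (begin
        (1# + q) * (s * f) * denominator 1 1
          ≈⟨ solve 5 (λ y u q s f →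
               (con 1ℤ :+ q) :* (s :* f) :* ((con 1ℤ :* (con 1ℤ :- (:- u) :* con 1ℤ)) :* (con 1ℤ :* (con 1ℤ :- y :* con 1ℤ)))
               := (con 1ℤ :+ q) :* ((con 1ℤ :+ u) :* f) :* (s :* (con 1ℤ :- y)))
               refl y u q s f ⟩
        (1# + q) * ((1# + u) * f) * (s * (1# - y))
          ≈⟨ *-congˡ (geometric-sum y k) ⟩
        (1# + q) * ((1# + u) * f) * (1# - u)
          -- Here `w` is `y ^ k-1`. One factor `u` of u² is unfolded to yw, which gives u² the shape
          -- y(wu) inverted by `f`.
          ≈⟨ solve 4 (λ y w q f →
               (con 1ℤ :+ q) :* ((con 1ℤ :+ y :* w) :* f) :* (con 1ℤ :- y :* w)
               := (con 1ℤ :+ q) :* (f :* (con 1ℤ :- y :* (w :* (y :* w)))))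
               refl y (y ^ k-1) q f ⟩
        (1# + q) * (f * (1# - y * (y ^ k-1 * u)))
          ≈⟨ *-congˡ eq ⟩
        (1# + q) * (1# + y ^ order * r)
          ≈⟨ solve 3 (λ q t r →
               (con 1ℤ :+ q) :* (con 1ℤ :+ t :* r)
               := con 1ℤ :* (con 1ℤ :- (:- q) :* con 1ℤ) :+ t :* ((con 1ℤ :+ q) :* r))
               refl q (y ^ order) r ⟩
        numerator 1 + y ^ order * ((1# + q) * r) ∎)
      where
      -- `f` is the truncated expansion of 1 / (1 - u²).
      open NonnegQuotient (quotient-1/[1-yw] order y≥0 (*-nonneg (^-nonneg k-1 y≥0) u≥0))
        renaming (quotient to f; remainder to r; quotient-nonneg to f≥0; division to eq)
      s = geometric y k

  -- The base cases for N ≥ 2 and the general inequality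

  module _ {y} (y≥0 : Nonneg y) where

    -- Expanding modulo y^(3k+2) gives
    --   (1 + q + q²)(1 + y + ⋯ + yᵏ⁻¹) + u² - u³ + u²q,
    -- and y³ᵏ = u³ is a term of q²(1 + y + ⋯ + yᵏ⁻¹) because k ≥ 2; deleting it
    -- leaves q²(s + yv).
    positive-2-2-1 : ∀ j → Truncation.Positive y≥0 (suc j) 2 2 1
    positive-2-2-1 j = quotient-cong uq²≈y^order refl refl (mkQuotient h≥0 (begin
        h * denominator 2 1
          -- Each `s` is grouped with 1 - y, so that `geometric-sum` eliminates it and leaves an
          -- identity in y and v once u = y²v is substituted.
          ≈⟨ solve 4 (λ y u v s → let q = y :* u in
               ((con 1ℤ :+ y :* (con 1ℤ :+ y :* s)) :* (con 1ℤ :+ q) :+ u :* u :+ u :* u :* q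
                 :+ q :* q :* (s :+ y :* v))
               :* (con 1ℤ :* (con 1ℤ :- (:- u) :* con 1ℤ) :* (con 1ℤ :- (:- u) :* (q :* con 1ℤ))
                 :* (con 1ℤ :* (con 1ℤ :- y :* con 1ℤ)))
               := (con 1ℤ :+ u) :* (con 1ℤ :+ u :* q)
                 :* (((con 1ℤ :+ y) :* (con 1ℤ :+ q) :+ u :* u :+ u :* u :* q :+ q :* q :* (y :* v)) :* (con 1ℤ :- y)
                   :+ (y :* y :* (con 1ℤ :+ q) :+ q :* q) :* (s :* (con 1ℤ :- y))))
               refl y u v s ⟩
        (1# + u) * (1# + u * q)
          * (((1# + y) * (1# + q) + u * u + u * u * q + q * q * (y * v)) * (1# - y)
            + (y * y * (1# + q) + q * q) * (s * (1# - y)))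
          ≈⟨ *-congˡ (+-congˡ (*-congˡ (geometric-sum y j))) ⟩
        (1# + u) * (1# + u * q)
          * (((1# + y) * (1# + q) + u * u + u * u * q + q * q * (y * v)) * (1# - y)
            + (y * y * (1# + q) + q * q) * (1# - v))
          -- The cofactor of `u * (q * q)` on the right is the explicit remainder that fills the `_`
          -- in the last line.
          ≈⟨ solve 2 (λ y v → let u = y :* (y :* v); q = y :* u in
               (con 1ℤ :+ u) :* (con 1ℤ :+ u :* q)
                 :* (((con 1ℤ :+ y) :* (con 1ℤ :+ q) :+ u :* u :+ u :* u :* q :+ q :* q :* (y :* v)) :* (con 1ℤ :- y)
                   :+ (y :* y :* (con 1ℤ :+ q) :+ q :* q) :* (con 1ℤ :- v))
               := con 1ℤ :* (con 1ℤ :- (:- q) :* con 1ℤ) :* (con 1ℤ :- (:- q) :* (q :* con 1ℤ))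
                 :+ u :* (q :* q)
                   :* (v :* (con (+ 2) :* y :+ y :* y :* y :- con 1ℤ :- con (+ 3) :* (y :* y)) :- y :- u :* u :* y
                     :+ u :* q :* v :* (con (+ 2) :* y :- con 1ℤ :- con (+ 2) :* (y :* y))))
               refl y v ⟩
        numerator 2 + u * (q * q) * _ ∎))
      where
      open Truncation y≥0 (suc j)
      v = y ^ j
      s = geometric y j
      h = geometric y k * (1# + q) + u * u + u * u * q + q * q * (s + y * v)
      h≥0 : Nonneg h
      h≥0 =
        +-nonneg (+-nonneg (+-nonneg
          (*-nonneg (geometric-nonneg k y≥0) (+-nonneg 1-nonneg q≥0))
          (*-nonneg u≥0 u≥0))
          (*-nonneg (*-nonneg u≥0 u≥0) q≥0))
          (*-nonneg (*-nonneg q≥0 q≥0) (+-nonneg (geometric-nonneg j y≥0) (^-nonneg (suc j) y≥0)))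

    -- For k = 1 the quotient with M = 1 has the coefficient -1 at y³, since q² = y⁴ comes too late
    -- to cancel -u³. The factor 1 - yq = 1 - y³ is therefore brought in, and the denominator
    -- becomes (1 - y²)(1 - y⁶).
    positive-2-2-2 : ∀ k-1 → Truncation.Positive y≥0 k-1 2 2 2
    positive-2-2-2 (suc j) = Truncation.positive-sucᴹ y≥0 (suc j) 2 2 1 (positive-2-2-1 j)
    positive-2-2-2 zero =
      quotient-cong refl
        (solve 1 (λ y → let q = y :* (y :* con 1ℤ) in
           (con 1ℤ :+ y :* y) :* (con 1ℤ :+ y :* (y :* (y :* y))) :* con 1ℤ :* con 1ℤ
           := con 1ℤ :* (con 1ℤ :- (:- q) :* con 1ℤ) :* (con 1ℤ :- (:- q) :* (q :* con 1ℤ)))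
          refl y)
        (solve 1 (λ y → let u = y :* con 1ℤ; q = y :* (y :* con 1ℤ) in
           con 1ℤ :* (con 1ℤ :- y :* y) :* (con 1ℤ :- y :* (y :* (y :* (y :* (y :* y)))))
           := (con 1ℤ :* (con 1ℤ :- (:- u) :* con 1ℤ) :* (con 1ℤ :- (:- u) :* (q :* con 1ℤ)))
              :* (con 1ℤ :* (con 1ℤ :- y :* con 1ℤ) :* (con 1ℤ :- y :* (q :* con 1ℤ))))
          refl y)
        -- 5 is the value of `order` at k = 1; the two inverted factors have w = y and w = y⁵.
        (quotient-* (quotient-* (quotient-x/1 numerator≥0) (quotient-1/[1-yw] 5 y≥0 y≥0))
          (quotient-1/[1-yw] 5 y≥0 (*-nonneg y≥0 (*-nonneg y≥0 (*-nonneg y≥0 (*-nonneg y≥0 y≥0))))))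
      where
      numerator≥0 : Nonneg ((1# + y * y) * (1# + y * (y * (y * y))))
      numerator≥0 = *-nonneg (+-nonneg 1-nonneg (*-nonneg y≥0 y≥0))
        (+-nonneg 1-nonneg (*-nonneg y≥0 (*-nonneg y≥0 (*-nonneg y≥0 y≥0))))

    -- From a base case, first M is raised, then N if it is at least 2, and finally the number of
    -- numerator factors. The hypothesis supplies M ≥ 1 in the first case and M ≥ 2 in the second,
    -- where the base case already has two factors of each kind.
    positive : ∀ k-1 N M → suc N ≤ M → Truncation.Positive y≥0 k-1 (N ℕ.+ M) (suc N) M
    positive k-1 zero M 1≤M =
      ≤-induction (λ l → Positive l 1 M) (positive-sucˡ 1 M) 1≤M
        (≤-induction (Positive 1 1) (positive-sucᴹ 1 1) 1≤M positive-1-1-1)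
      where open Truncation y≥0 k-1
    positive k-1 (suc N) M 2+N≤M =
      ≤-induction (λ l → Positive l (2 ℕ.+ N) M) (positive-sucˡ (2 ℕ.+ N) M) (ℕ.≤-trans 2≤M (ℕ.m≤n+m M (suc N)))
        (≤-induction (λ n → Positive 2 (2 ℕ.+ n) M) (positive-sucᴺ 2 M) {n = N} z≤n
          (≤-induction (Positive 2 2) (positive-sucᴹ 2 2) 2≤M (positive-2-2-2 k-1)))
      where
      open Truncation y≥0 k-1
      2≤M : 2 ≤ M
      2≤M = ℕ.≤-trans (s≤s (s≤s z≤n)) 2+N≤M

-- The commutative ring of integer power series

module PowerSeries where

  open import Defs
  open import Algebra.Properties.CommutativeMonoid.Sum ℤ.+-0-commutativeMonoid using (sum-cong-≗; ∑-distrib-+)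
  open import Algebra.Properties.Semiring.Sum ℤ.+-*-semiring using (*-distribˡ-sum)

  infixl 6 _+_
  infixr 7 _•_

  𝟘 : Series
  𝟘 _ = 0ℤ

  _+_ : Series → Series → Series
  (f + g) n = f n ℤ.+ g n

  _•_ : ℤ → Series → Series
  (c • f) n = c ℤ.* f n

  tail : Series → Series
  tail f = f ∘ suc

  *-cong : ∀ {f f′ g g′} → f ≗ f′ → g ≗ g′ → f * g ≗ f′ * g′
  *-cong p q n = sum-cong-≗ {suc n} λ i → ≡.cong₂ ℤ._*_ (p (toℕ i)) (q (n ∸ toℕ i))

  *-distribʳ-+ : ∀ h f g → (f + g) * h ≗ f * h + g * h
  *-distribʳ-+ h f g n =
    ≡.trans (sum-cong-≗ {suc n} λ i → ℤ.*-distribʳ-+ (h (n ∸ toℕ i)) (f (toℕ i)) (g (toℕ i)))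
          (∑-distrib-+ {suc n} (λ i → f (toℕ i) ℤ.* h (n ∸ toℕ i)) (λ i → g (toℕ i) ℤ.* h (n ∸ toℕ i)))

  •-*-assoc : ∀ c f g → (c • f) * g ≗ c • (f * g)
  •-*-assoc c f g n =
    ≡.trans (sum-cong-≗ {suc n} λ i → ℤ.*-assoc c (f (toℕ i)) (g (n ∸ toℕ i)))
          (≡.sym (*-distribˡ-sum {suc n} c (λ i → f (toℕ i) ℤ.* g (n ∸ toℕ i))))

  -- The inductions on n below use that (f * g) (suc n) unfolds to
  -- f 0 * g (suc n) + (tail f * g) n.

  *-zeroˡ : ∀ f → 𝟘 * f ≗ 𝟘
  *-zeroˡ f zero    = ≡.refl
  *-zeroˡ f (suc n) = ≡.trans (ℤ.+-identityˡ _) (*-zeroˡ f n)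

  *-identityˡ : ∀ f → 𝟙 * f ≗ f
  *-identityˡ f zero    = ≡.trans (ℤ.+-identityʳ _) (ℤ.*-identityˡ (f 0))
  *-identityˡ f (suc n) =
    ≡.trans (≡.cong₂ ℤ._+_ (ℤ.*-identityˡ (f (suc n))) (*-zeroˡ f n)) (ℤ.+-identityʳ (f (suc n)))

  -- Splits off the last summand of the convolution, whereas the definition splits off the first;
  -- commutativity follows by comparing the two.
  *-suc : ∀ f g n → (f * g) (suc n) ≡ (f * tail g) n ℤ.+ f (suc n) ℤ.* g 0
  *-suc f g zero = ≡.cong₂ ℤ._+_ (≡.sym (ℤ.+-identityʳ (f 0 ℤ.* g 1))) (ℤ.+-identityʳ (f 1 ℤ.* g 0))
  *-suc f g (suc n) =
    ≡.trans (≡.cong (λ z → f 0 ℤ.* g (suc (suc n)) ℤ.+ z) (*-suc (tail f) g n))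
          (≡.sym (ℤ.+-assoc (f 0 ℤ.* g (suc (suc n))) ((tail f * tail g) n) (f (suc (suc n)) ℤ.* g 0)))

  *-comm : ∀ f g → f * g ≗ g * f
  *-comm f g zero    = ≡.cong (ℤ._+ 0ℤ) (ℤ.*-comm (f 0) (g 0))
  *-comm f g (suc n) =
    ≡.trans (≡.cong₂ ℤ._+_ (ℤ.*-comm (f 0) (g (suc n))) (*-comm (tail f) g n))
    (≡.trans (ℤ.+-comm (g (suc n) ℤ.* f 0) ((g * tail f) n))
           (≡.sym (*-suc g f n)))

  *-assoc : ∀ f g h → (f * g) * h ≗ f * (g * h)
  *-assoc f g h zero = begin
    (f 0 ℤ.* g 0 ℤ.+ 0ℤ) ℤ.* h 0 ℤ.+ 0ℤ ≡⟨ ≡.cong (λ z → z ℤ.* h 0 ℤ.+ 0ℤ) (ℤ.+-identityʳ (f 0 ℤ.* g 0)) ⟩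
    f 0 ℤ.* g 0 ℤ.* h 0 ℤ.+ 0ℤ          ≡⟨ ≡.cong (ℤ._+ 0ℤ) (ℤ.*-assoc (f 0) (g 0) (h 0)) ⟩
    f 0 ℤ.* (g 0 ℤ.* h 0) ℤ.+ 0ℤ        ≡⟨ ≡.cong (λ z → f 0 ℤ.* z ℤ.+ 0ℤ) (ℤ.+-identityʳ (g 0 ℤ.* h 0)) ⟨
    f 0 ℤ.* (g 0 ℤ.* h 0 ℤ.+ 0ℤ) ℤ.+ 0ℤ ∎
    where open ≡-Reasoning
  *-assoc f g h (suc n) = begin
    (f 0 ℤ.* g 0 ℤ.+ 0ℤ) ℤ.* h (suc n) ℤ.+ (tail (f * g) * h) n
      -- By definition `tail (f * g)` is `(f 0 • tail g) + tail f * g`, so the product with `h`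
      -- distributes and the induction applies to `tail f`.
      ≡⟨ ≡.cong₂ ℤ._+_ (≡.cong (ℤ._* h (suc n)) (ℤ.+-identityʳ (f 0 ℤ.* g 0)))
                     (*-distribʳ-+ h (f 0 • tail g) (tail f * g) n) ⟩
    f 0 ℤ.* g 0 ℤ.* h (suc n) ℤ.+ (((f 0 • tail g) * h) n ℤ.+ ((tail f * g) * h) n)
      ≡⟨ ≡.cong₂ ℤ._+_ (ℤ.*-assoc (f 0) (g 0) (h (suc n)))
                     (≡.cong₂ ℤ._+_ (•-*-assoc (f 0) (tail g) h n) (*-assoc (tail f) g h n)) ⟩
    f 0 ℤ.* (g 0 ℤ.* h (suc n)) ℤ.+ (f 0 ℤ.* (tail g * h) n ℤ.+ (tail f * (g * h)) n)
      ≡⟨ ℤ.+-assoc (f 0 ℤ.* (g 0 ℤ.* h (suc n))) (f 0 ℤ.* (tail g * h) n) _ ⟨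
    f 0 ℤ.* (g 0 ℤ.* h (suc n)) ℤ.+ f 0 ℤ.* (tail g * h) n ℤ.+ (tail f * (g * h)) n
      ≡⟨ ≡.cong (ℤ._+ (tail f * (g * h)) n) (ℤ.*-distribˡ-+ (f 0) (g 0 ℤ.* h (suc n)) ((tail g * h) n)) ⟨
    f 0 ℤ.* (g * h) (suc n) ℤ.+ (tail f * (g * h)) n ∎
    where open ≡-Reasoning

  commutativeRing : CommutativeRing 0ℓ 0ℓ
  commutativeRing = record
    { Carrier = Series
    ; _≈_     = _≗_
    ; _+_     = _+_
    ; _*_     = _*_
    ; -_      = -_
    ; 0#      = 𝟘
    ; 1#      = 𝟙
    ; isCommutativeRing = record
      { isRing = record
        { +-isAbelianGroup = record
          { isGroup = record
            { isMonoid = record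
              { isSemigroup = record
                { isMagma = record
                  { isEquivalence = record
                    { refl  = λ _ → ≡.refl
                    ; sym   = λ p n → ≡.sym (p n)
                    ; trans = λ p q n → ≡.trans (p n) (q n)
                    }
                  ; ∙-cong = λ p q n → ≡.cong₂ ℤ._+_ (p n) (q n)
                  }
                ; assoc = λ f g h n → ℤ.+-assoc (f n) (g n) (h n)
                }
              ; identity = (λ f n → ℤ.+-identityˡ (f n)) , (λ f n → ℤ.+-identityʳ (f n))
              }
            ; inverse = (λ f n → ℤ.+-inverseˡ (f n)) , (λ f n → ℤ.+-inverseʳ (f n))
            ; ⁻¹-cong = λ p n → ≡.cong ℤ.-_ (p n)
            }
          ; comm = λ f g n → ℤ.+-comm (f n) (g n)
          }
        ; *-cong     = *-cong
        ; *-assoc    = *-assoc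
        ; *-identity = comm∧idˡ⇒id *-comm *-identityˡ
        ; distrib    = comm∧distrʳ⇒distr (λ p q n → ≡.cong₂ ℤ._+_ (p n) (q n)) *-comm *-distribʳ-+
        }
      ; *-comm = *-comm
      }
    }
    where
    open import Relation.Binary.PropositionalEquality using (_→-setoid_)
    open import Algebra.Consequences.Setoid (ℕ →-setoid ℤ)

  X*-suc : ∀ f n → (X * f) (suc n) ≡ f n
  X*-suc f n = begin
    0ℤ ℤ.+ (tail X * f) n   ≡⟨ ℤ.+-identityˡ _ ⟩
    (tail X * f) n          ≡⟨ *-cong {g = f} tailX≗𝟙 (λ _ → ≡.refl) n ⟩
    (𝟙 * f) n               ≡⟨ *-identityˡ f n ⟩
    f n                     ∎
    where
    open ≡-Reasoning
    tailX≗𝟙 : tail X ≗ 𝟙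
    tailX≗𝟙 zero    = ≡.refl
    tailX≗𝟙 (suc _) = ≡.refl

  X^*-< : ∀ m f n → n < m → (X ^ m * f) n ≡ 0ℤ
  X^*-< (suc m) f n n<m = ≡.trans (*-assoc X (X ^ m) f n) (shifted n n<m)
    where
    shifted : ∀ n → n < suc m → (X * (X ^ m * f)) n ≡ 0ℤ
    shifted zero    _         = ≡.refl
    shifted (suc n) (s≤s n<m) = ≡.trans (X*-suc (X ^ m * f) n) (X^*-< m f n n<m)

  -- Series with nonnegative coefficients

  Nonneg : Series → Set
  Nonneg f = ∀ n → 0ℤ ℤ.≤ f n

  𝟙-nonneg : Nonneg 𝟙
  𝟙-nonneg zero    = ℤ.+≤+ z≤n
  𝟙-nonneg (suc _) = ℤ.≤-refl

  X-nonneg : Nonneg X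
  X-nonneg zero          = ℤ.≤-refl
  X-nonneg (suc zero)    = ℤ.+≤+ z≤n
  X-nonneg (suc (suc _)) = ℤ.≤-refl

  +-nonneg : ∀ {f g} → Nonneg f → Nonneg g → Nonneg (f + g)
  +-nonneg p q n = ℤ.+-mono-≤ (p n) (q n)

  *-nonneg : ∀ {f g} → Nonneg f → Nonneg g → Nonneg (f * g)
  -- The induction passes from `f` to its tail, so `f` is generalised while `g` stays fixed.
  *-nonneg {f} {g} p q = convolution-nonneg f p
    where
    product-nonneg : ∀ {i j} → 0ℤ ℤ.≤ i → 0ℤ ℤ.≤ j → 0ℤ ℤ.≤ i ℤ.* j
    product-nonneg {i} {j} 0≤i 0≤j = ℤ.*-monoʳ-≤-nonNeg j {{ℤ.nonNegative 0≤j}} 0≤i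
    convolution-nonneg : ∀ f → Nonneg f → Nonneg (f * g)
    convolution-nonneg f p zero    = ℤ.+-mono-≤ (product-nonneg (p 0) (q 0)) ℤ.≤-refl
    convolution-nonneg f p (suc n) =
      ℤ.+-mono-≤ (product-nonneg (p 0) (q (suc n))) (convolution-nonneg (tail f) (p ∘ suc) n)

  nonnegativeCone : Cone commutativeRing 0ℓ
  nonnegativeCone = record
    { Nonneg   = Nonneg
    ; 0-nonneg = λ _ → ℤ.≤-refl
    ; 1-nonneg = 𝟙-nonneg
    ; +-nonneg = +-nonneg
    ; *-nonneg = *-nonneg
    }

  -- From quotients modulo a power of X to coefficients

  open CommutativeRing commutativeRing using (setoid; +-congˡ; +-congʳ; *-congˡ; *-congʳ; -‿cong; commutativeSemiring)
  open CommutativeRing commutativeRing public using (*-identityʳ)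
  open import Algebra.Properties.CommutativeSemiring.Exp commutativeSemiring
    using (^-congʳ; ^-assocʳ)
  open import Algebra.Properties.CommutativeSemiring.Exp commutativeSemiring public
    using () renaming (_^_ to _^′_)
  open IntegerSolver commutativeRing
  open NonnegativeQuotients commutativeRing nonnegativeCone

  -- Bridges the power used in the statement and the generic semiring power used in the abstract
  -- argument.
  ^≗^′ : ∀ {f f′} n → f ≗ f′ → f ^ n ≗ f′ ^′ n
  ^≗^′ zero    f≗f′ _ = ≡.refl
  ^≗^′ (suc n) f≗f′   = *-cong f≗f′ (^≗^′ n f≗f′)

  poch≗pochhammer : ∀ {z z′ q q′} n → z ≗ z′ → q ≗ q′ → poch z q n ≗ pochhammer z′ q′ n
  poch≗pochhammer zero    z≗z′ q≗q′ _ = ≡.refl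
  poch≗pochhammer (suc n) z≗z′ q≗q′   =
    *-cong (poch≗pochhammer n z≗z′ q≗q′) (λ i → ≡.cong (λ x → 𝟙 i ℤ.- x) (*-cong z≗z′ (^≗^′ n q≗q′) i))

  X^-* : ∀ b n → X ^ (n ℕ.* b) ≗ (X ^′ b) ^′ n
  X^-* b n = begin
    X ^ (n ℕ.* b)      ≈⟨ ^≗^′ (n ℕ.* b) (λ _ → ≡.refl) ⟩
    X ^′ (n ℕ.* b)     ≈⟨ ^-congʳ X (ℕ.*-comm n b) ⟩
    X ^′ (b ℕ.* n)     ≈⟨ ^-assocʳ X b n ⟨
    (X ^′ b) ^′ n      ∎
    where open import Relation.Binary.Reasoning.Setoid setoid

  -- Multiplying hd = p + tr by the inverse of d gives p / d = h - t(r / d), and multiples of t = Xᵐ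
  -- vanish below degree m.
  coefficient-nonneg : ∀ {m p d} → d 0 ≡ 1ℤ → NonnegQuotient (X ^ m) p d → ∀ n → n < m → 0ℤ ℤ.≤ (p / d) n
  coefficient-nonneg {m} {p} {d} d₀≡1 (mkQuotient {h} {r} h≥0 hd≗p+tr) n n<m =
    ≡.subst (0ℤ ℤ.≤_) (≡.sym p/d≡h) (h≥0 n)
    where
    t = X ^ m
    p/d≗h+t* : p / d ≗ h + t * (- (r * d ⁻¹))
    p/d≗h+t* = begin
      p * d ⁻¹
        ≈⟨ solve 4 (λ p t r i → p :* i := (p :+ t :* r) :* i :+ t :* (:- (r :* i))) (λ _ → ≡.refl) p t r (d ⁻¹) ⟩
      (p + t * r) * d ⁻¹ + t * (- (r * d ⁻¹))
        ≈⟨ +-congʳ {t * (- (r * d ⁻¹))} (*-congʳ {d ⁻¹} hd≗p+tr) ⟨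
      (h * d) * d ⁻¹ + t * (- (r * d ⁻¹))
        ≈⟨ +-congʳ {t * (- (r * d ⁻¹))} (*-assoc h d (d ⁻¹)) ⟩
      h * (d * d ⁻¹) + t * (- (r * d ⁻¹))
        ≈⟨ +-congʳ {t * (- (r * d ⁻¹))} (*-congˡ {h} (*-inverseʳ d d₀≡1)) ⟩
      h * 𝟙 + t * (- (r * d ⁻¹))
        ≈⟨ +-congʳ {t * (- (r * d ⁻¹))} (*-identityʳ h) ⟩
      h + t * (- (r * d ⁻¹)) ∎
      where open import Relation.Binary.Reasoning.Setoid setoid
    p/d≡h : (p / d) n ≡ h n
    p/d≡h = ≡.trans (p/d≗h+t* n)
      (≡.trans (≡.cong (λ x → h n ℤ.+ x) (X^*-< m (- (r * d ⁻¹)) n n<m)) (ℤ.+-identityʳ (h n)))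

  -- Common source of both forms, with y = Xᵇ and b = 1 for `G`. The series u, q, y are fixed only
  -- up to `_≗_`, because `g` and `G` write their exponents differently. The first length is
  -- `suc N`, which turns N + M ∸ 1 into `N ℕ.+ M`.
  poch-quotient-nonneg : ∀ b k-1 N M {u q y} → let k = suc k-1 in
    u ≗ (X ^′ b) ^′ k → q ≗ (X ^′ b) ^′ suc k → y ≗ X ^′ b →
    (poch (- u) q (suc N) * poch y q M) 0 ≡ 1ℤ → suc N ≤ M →
    ∀ n → n < (k ℕ.+ (suc k ℕ.+ suc k)) ℕ.* b →
    0ℤ ℤ.≤ (poch (- q) q (N ℕ.+ M) / (poch (- u) q (suc N) * poch y q M)) n
  poch-quotient-nonneg b k-1 N M u≗ q≗ y≗ d₀≡1 N<M =
    coefficient-nonneg d₀≡1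
      (quotient-cong
        (λ n → ≡.sym (X^-* b order n))
        (λ n → ≡.sym (poch≗pochhammer (N ℕ.+ M) (-‿cong q≗) q≗ n))
        (λ n → ≡.sym (*-cong (poch≗pochhammer (suc N) (-‿cong u≗) q≗) (poch≗pochhammer M y≗ q≗) n))
        (positive X^b≥0 k-1 N M N<M))
    where
    X^b≥0 = ^-nonneg b X-nonneg
    open Truncation X^b≥0 k-1 using (order)

-- The two forms of the theorem

open import Defs using (X; _^_; g; G; [X^_]_; gDenominator-constant; GDenominator-constant)
open import Data.Integer.Base using (0ℤ) renaming (_≤_ to _≤ᶻ_)
open import Data.Nat.Base using (ℕ; NonZero; _+_; _*_; _≤_; _<_)
open import Data.Nat.Divisibility using (_∣_; divides)
open import Data.Product.Base using (_×_)
open import Data.Nat.Solver using (module +-*-Solver)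
open import Relation.Nullary.Negation using (contradiction)
open +-*-Solver using (solve; _:=_; _:+_; _:*_; con)
open PowerSeries using (_^′_; X^-*; ^≗^′; *-identityʳ; poch-quotient-nonneg)

theorem1p4 : ( (a b N M : ℕ) → .{{NonZero a}} → .{{NonZero b}} → .{{NonZero N}} → .{{NonZero M}} →
    b ∣ a → N ≤ M →
    (n : ℕ) → n < a + 2 * (a + b) → 0ℤ ≤ᶻ [X^ n ] g a b (a + b) N M )
    ×
    ( (k N M : ℕ) → .{{NonZero k}} → .{{NonZero N}} → .{{NonZero M}} →
    N ≤ M →
    (r : ℕ) → r < 3 * k + 2 → 0ℤ ≤ᶻ [X^ r ] G k N M )
theorem1p4 = g-nonneg , G-nonneg
  where
  g-nonneg : (a b N M : ℕ) → .{{NonZero a}} → .{{NonZero b}} → .{{NonZero N}} → .{{NonZero M}} →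
             b ∣ a → N ≤ M →
             (n : ℕ) → n < a + 2 * (a + b) → 0ℤ ≤ᶻ [X^ n ] g a b (a + b) N M
  g-nonneg a b (suc N) M (divides zero a≡0) N<M n n< = contradiction a≡0 (ℕ.≢-nonZero⁻¹ a)
  g-nonneg a b (suc N) M (divides k@(suc k-1) ≡.refl) N<M n n< =
    poch-quotient-nonneg b k-1 N M (X^-* b k) q≗ y≗
      (gDenominator-constant (k * b) b (k * b + b) (suc N) M) N<M n
      -- With a = kb, the bound a + 2(a + b) is (3k + 2)b, the truncation order in y = Xᵇ measured
      -- in powers of X.
      (≡.subst (n <_) (solve 2 (λ k b → k :* b :+ con 2 :* (k :* b :+ b)
          := (k :+ ((con 1 :+ k) :+ (con 1 :+ k))) :* b) ≡.refl k b) n<)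
    where
    q≗ : X ^ (k * b + b) ≗ (X ^′ b) ^′ suc k
    q≗ n = ≡.trans (≡.cong (λ m → (X ^ m) n) (ℕ.+-comm (k * b) b)) (X^-* b (suc k) n)
    y≗ : X ^ b ≗ X ^′ b
    y≗ = ^≗^′ b (λ _ → ≡.refl)

  G-nonneg : (k N M : ℕ) → .{{NonZero k}} → .{{NonZero N}} → .{{NonZero M}} →
             N ≤ M →
             (r : ℕ) → r < 3 * k + 2 → 0ℤ ≤ᶻ [X^ r ] G k N M
  G-nonneg k@(suc k-1) (suc N) M N<M r r< =
    poch-quotient-nonneg 1 k-1 N M (X^≗ k ≡.refl) (X^≗ (suc k) (ℕ.+-comm k 1))
      (λ n → ≡.sym (*-identityʳ X n))
      (GDenominator-constant k (suc N) M) N<M r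
      (≡.subst (r <_) (solve 1 (λ k → con 3 :* k :+ con 2
          := (k :+ ((con 1 :+ k) :+ (con 1 :+ k))) :* con 1) ≡.refl k) r<)
    where
    X^≗ : ∀ n {m} → m ≡ n → X ^ m ≗ (X ^′ 1) ^′ n
    X^≗ n ≡.refl i = ≡.trans (≡.cong (λ m → (X ^ m) i) (≡.sym (ℕ.*-identityʳ n))) (X^-* 1 n i)
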